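{- Let $(A,B)\in\{(16,14),(36,30),(72,42),(196,70),(252,114)\}$ and let $N=An+B$ for some nonnegative integer $n$. Then $$\sum_{1\le k<\sqrt{N}}\sigma_0(N-k^2)\equiv 0 \pmod 4,$$ where the sum runs over positive integers $k$ with $k<\sqrt N$.
   Context: For a positive integer $m$, $\sigma_0(m)$ denotes the number of positive divisors of $m$. -}

module Defs where

open import Data.Nat using (ℕ; suc; _+_; _*_; _∸_; _<_; _<?_)
open import Data.Nat.Divisibility using (_∣_; _∣?_)
open import Data.List using (List; length; filter; map; upTo)
open import Data.Nat.ListAction using (sum)

positivesUpTo : ℕ → List ℕ
positivesUpTo m = map suc (upTo m)

-- σ₀ m = number of positive divisors of m (all divisors of m ≥ 1 lie in 1..m)
σ₀ : ℕ → ℕ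
σ₀ m = length (filter (_∣? m) (positivesUpTo m))

-- Σ_{1 ≤ k < √N} σ₀(N - k²); the condition k < √N is k * k < N for k ≥ 1,
-- and every such k lies in 1..N
divisorSumOverSquares : ℕ → ℕ
divisorSumOverSquares N =
  sum (map (λ k → σ₀ (N ∸ k * k)) (filter (λ k → k * k <? N) (positivesUpTo N)))

data AdmissiblePair : ℕ → ℕ → Set where
  p16-14  : AdmissiblePair 16 14
  p36-30  : AdmissiblePair 36 30
  p72-42  : AdmissiblePair 72 42
  p196-70 : AdmissiblePair 196 70
  p252-114 : AdmissiblePair 252 114

{-# OPTIONS --safe #-}
module Submission where

open import Defs
open import Data.Nat
  using (ℕ; zero; suc; _+_; _*_; _∸_; _<_; _≤_; _<?_; _≟_; _%_; _/_; s≤s; z≤n; z<s; NonZero;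
         >-nonZero)
open import Data.Nat.Properties
open import Data.Nat.DivMod
  using (%-distribˡ-+; %-distribˡ-*; m≡m%n+[m/n]*n; [m+kn]%n≡m%n; m*n%n≡0; m%n<n;
         m∣n⇒o%n%m≡o%m)
open import Data.Nat.Divisibility
  using (_∣_; _∣?_; divides; ∣m+n∣m⇒∣n; *-monoʳ-∣; m∣m*n; m%n≡0⇒n∣m; n∣m⇒m%n≡0)
open import Data.Nat.ListAction using (sum)
open import Data.Nat.Tactic.RingSolver using (solve-∀)
open import Data.List using (List; []; _∷_; length; map; filter; upTo; _++_; cartesianProduct)
open import Data.List.Properties using (length-map; length-++)
open import Data.List.Membership.Propositional using (_∈_)
open import Data.List.Membership.Propositional.Properties
  using (∈-map⁺; ∈-map⁻; ∈-filter⁺; ∈-filter⁻; ∈-++⁺ˡ; ∈-++⁺ʳ; ∈-++⁻; ∈-upTo⁺;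
         ∈-cartesianProduct⁺)
open import Data.List.Membership.Propositional.Properties.WithK using (unique∧set⇒bag)
open import Data.List.Relation.Binary.BagAndSetEquality using (∼bag⇒↭)
open import Data.List.Relation.Binary.Permutation.Propositional.Properties using (↭-length)
open import Data.List.Relation.Unary.All as All using (All; []; _∷_)
open import Data.List.Relation.Unary.AllPairs using ([]; _∷_)
open import Data.List.Relation.Unary.Any using (here; there)
open import Data.List.Relation.Unary.Unique.Propositional using (Unique)
import Data.List.Relation.Unary.Unique.Propositional.Properties as Unique
open import Data.Product using (∃; ∃₂; ∃-syntax; _×_; _,_; proj₁; proj₂)
open import Data.Product.Properties using (,-injectiveʳ)
open import Data.Sum using (inj₁; inj₂)
open import Data.Empty using (⊥-elim)
open import Function using (_∘_; mk⇔)
open import Relation.Binary.PropositionalEquality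
  using (_≡_; _≢_; refl; sym; trans; cong; cong₂; subst; subst₂; module ≡-Reasoning)
open import Relation.Nullary using (Dec; ¬_; yes; no)
open import Relation.Nullary.Decidable using (from-yes; _×-dec_; _→-dec_; ¬?)
open import Relation.Unary using (Decidable; _∩_; ∁)

-- In each case N ≡ 2 (mod 4), and N is not a sum of two squares, by its residue
-- mod 16, 9 or 49. The sum counts the positive solutions of k² + yz = N. Those
-- with y ≡ z (mod 4) have y ≠ z and pair up under y ↔ z; the others have k and
-- exactly one of y, z even. So the sum is 2 (#OddTriples + #EvenTriples), and it
-- remains to see that these two numbers have the same parity. The involution
-- u ↔ z shows that #EvenTriples has the parity of #{4j² + 2u² = N}. Zagier's
-- involution on k² + x² + 4yz = N, with k fixed, has OddTriples as fixed points;
-- the involution y ↔ z has the solutions of k² + x² + 4y² = N as fixed points,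
-- on which k ↔ x leaves 2u² + 4j² = N.

-- Counting

-- Finite sets are given by duplicate-free lists, so that filtering, concatenation and preimages act
-- on them directly.
record Card {A : Set} (P : A → Set) (n : ℕ) : Set where
  constructor card
  field
    elements : List A
    unique   : Unique elements
    sound    : ∀ {a} → a ∈ elements → P a
    complete : ∀ {a} → P a → a ∈ elements
    size     : length elements ≡ n

module _ {A : Set} {P : A → Set} where

  -- Duplicate-free lists with the same members are equal as bags, hence permutations of each other.
  -- This identifies counts of one set that were reached in different ways.
  card-unique : ∀ {m n} → Card P m → Card P n → m ≡ n
  card-unique (card _ u s c refl) (card _ u′ s′ c′ refl) =
    ↭-length (∼bag⇒↭ (unique∧set⇒bag u u′ (mk⇔ (c′ ∘ s) (c ∘ s′))))

  card-empty : ∀ {n} → Card P n → (∀ a → ¬ P a) → n ≡ 0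
  card-empty (card []      _ _ _ refl) _ = refl
  card-empty (card (a ∷ _) _ s _ _)    e = ⊥-elim (e a (s (here refl)))

  card-cong : ∀ {n} {Q : A → Set} → (∀ {a} → P a → Q a) → (∀ {a} → Q a → P a) →
    Card P n → Card Q n
  card-cong to from (card l u s c e) = card l u (to ∘ s) (c ∘ from) e

  card-filter : ∀ {Q : A → Set} (Q? : Decidable Q) {n} → Card P n →
    ∃[ m ] Card (P ∩ Q) m
  card-filter Q? (card l u s c _) = _ , card (filter Q? l) (Unique.filter⁺ Q? u)
    (λ a∈ → let a∈l , q = ∈-filter⁻ Q? a∈ in s a∈l , q)
    (λ (p , q) → ∈-filter⁺ Q? (c p) q) refl

module _ {A B : Set} {P : A → Set} {Q : B → Set} where

  -- Preimages are chosen one by one along the list for `Q`, so no inverse function has to be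
  -- written. The chosen list is duplicate-free because its image under `f` is.
  card-pullback : ∀ {n} (f : A → B) → (∀ {a} → P a → Q (f a)) →
    (∀ {a a′} → P a → P a′ → f a ≡ f a′ → a ≡ a′) →
    (∀ {b} → Q b → ∃[ a ] P a × f a ≡ b) →
    Card Q n → Card P n
  card-pullback f P⇒Q inj surj (card l u s c e) with choose l (All.tabulate s)
    where
    choose : ∀ l → All Q l → ∃[ l′ ] All P l′ × map f l′ ≡ l
    choose []      []       = [] , [] , refl
    choose (_ ∷ l) (q ∷ qs) with surj q | choose l qs
    ... | a , p , refl | l′ , ps , refl = a ∷ l′ , p ∷ ps , refl
  ... | l′ , ps , refl = card l′ (Unique.map⁻ u) (All.lookup ps) complete
                           (trans (sym (length-map f l′)) e)
    where
    complete : ∀ {a} → P a → a ∈ l′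
    complete p with ∈-map⁻ f (c (P⇒Q p))
    ... | a′ , a′∈ , eq with inj p (All.lookup ps a′∈) eq
    ...   | refl = a′∈

module _ {A : Set} {P : A → Set} {n : ℕ} (#P : Card P n) where

  -- The two sublists, concatenated, enumerate `P` a second time; `card-unique` then gives the sum.
  card-split : ∀ {Q : A → Set} → Decidable Q →
    ∃₂ λ m k → Card (P ∩ Q) m × Card (P ∩ ∁ Q) k × n ≡ m + k
  card-split {Q} Q? with card-filter Q? #P | card-filter (¬? ∘ Q?) #P
  ... | m , M | k , K = m , k , M , K , card-unique #P (union M K)
    where
    union : ∀ {m k} → Card (P ∩ Q) m → Card (P ∩ ∁ Q) k → Card P (m + k)
    union (card l u s c refl) (card l′ u′ s′ c′ refl) = card (l ++ l′)
      (Unique.++⁺ u u′ λ (a∈l , a∈l′) → proj₂ (s′ a∈l′) (proj₂ (s a∈l)))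
      sound complete (length-++ l)
      where
      sound : ∀ {a} → a ∈ l ++ l′ → P a
      sound a∈ with ∈-++⁻ l a∈
      ... | inj₁ a∈l  = proj₁ (s a∈l)
      ... | inj₂ a∈l′ = proj₁ (s′ a∈l′)
      complete : ∀ {a} → P a → a ∈ l ++ l′
      complete {a} p with Q? a
      ... | yes q = ∈-++⁺ˡ (c (p , q))
      ... | no ¬q = ∈-++⁺ʳ l (c′ (p , ¬q))

module _ {A : Set} {P : A → Set} (u v : A → ℕ) where

  card-trichotomy : ∀ {n} → Card P n → ∃[ l ] ∃[ e ] ∃[ g ]
    Card (P ∩ λ a → u a < v a) l × Card (P ∩ λ a → u a ≡ v a) e ×
    Card (P ∩ λ a → v a < u a) g × n ≡ l + (e + g)
  card-trichotomy #P with card-split #P (λ a → u a <? v a)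
  ... | l , _ , L , #P≮ , refl with card-split #P≮ (λ a → u a ≟ v a)
  ...   | e , g , E , G , refl = l , e , g , L
    , card-cong (λ ((p , _) , u≡v) → p , u≡v)
                (λ (p , u≡v) → (p , <-irrefl u≡v) , u≡v) E
    , card-cong (λ ((p , u≮v) , u≢v) → p , ≤∧≢⇒< (≮⇒≥ u≮v) (u≢v ∘ sym))
                (λ (p , v<u) → (p , <-asym v<u) , >⇒≢ v<u) G
    , refl

  -- The involution exchanges `u` and `v`, so it carries the part u < v bijectively onto the part v
  -- < u. Modulo 2 only the part u = v survives.
  card-swap : ∀ {n} (σ : A → A) → (∀ a → σ (σ a) ≡ a) → (∀ a → u (σ a) ≡ v a) →
    (∀ {a} → P a → P (σ a)) → Card P n → ∃₂ λ m e →
    Card (P ∩ λ a → u a < v a) m × Card (P ∩ λ a → u a ≡ v a) e × n ≡ m + m + e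
  card-swap σ σσ uσ Pσ #P with card-trichotomy #P
  ... | m , e , g , M , E , G , refl = m , e , M , E ,
    trans (cong (λ x → m + (e + x)) (sym (card-unique M G′))) (rearrange m e)
    where
    rearrange : ∀ m e → m + (e + m) ≡ m + m + e
    rearrange = solve-∀
    vσ : ∀ a → v (σ a) ≡ u a
    vσ a = trans (sym (uσ (σ a))) (cong u (σσ a))
    G′ : Card (P ∩ λ a → u a < v a) g
    G′ = card-pullback σ
      (λ {a} (p , u<v) → Pσ p , subst (_< u (σ a)) (sym (vσ a)) (subst (u a <_) (sym (uσ a)) u<v))
      (λ {a} {a′} _ _ eq → trans (sym (σσ a)) (trans (cong σ eq) (σσ a′)))
      (λ {b} (p , v<u) → σ b ,
        (Pσ p , subst (_< v (σ b)) (sym (uσ b)) (subst (v b <_) (sym (vσ b)) v<u)) , σσ b)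
      G

-- Turns a sum of list lengths into a number of pairs; it is applied to the roots k and the divisors
-- of N - k².
card-Σ : ∀ {A B : Set} {as : List A} (bs : A → List B) → Unique as → (∀ a → Unique (bs a)) →
  Card (λ (a , b) → a ∈ as × b ∈ bs a) (sum (map (length ∘ bs) as))
card-Σ {as = []}     bs []         ubs = card [] [] (λ ()) (λ ()) refl
card-Σ {A} {B} {as = a ∷ as} bs (a∉as ∷ uas) ubs with card-Σ bs uas ubs
... | card l u s c e = card (map (a ,_) (bs a) ++ l)
  (Unique.++⁺ (Unique.map⁺ ,-injectiveʳ (ubs a)) u disjoint)
  sound complete
  (trans (length-++ (map (a ,_) (bs a))) (cong₂ _+_ (length-map (a ,_) (bs a)) e))
  where
  disjoint : ∀ {x} → ¬ (x ∈ map (a ,_) (bs a) × x ∈ l)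
  disjoint (x∈ , x∈l) with ∈-map⁻ (a ,_) x∈
  ... | _ , _ , refl = All.lookup a∉as (proj₁ (s x∈l)) refl
  sound : ∀ {x} → x ∈ map (a ,_) (bs a) ++ l → proj₁ x ∈ a ∷ as × proj₂ x ∈ bs (proj₁ x)
  sound x∈ with ∈-++⁻ (map (a ,_) (bs a)) x∈
  ... | inj₂ x∈l = let a∈ , b∈ = s x∈l in there a∈ , b∈
  ... | inj₁ x∈m with ∈-map⁻ (a ,_) x∈m
  ...   | _ , b∈ , refl = here refl , b∈
  complete : ∀ {x} → proj₁ x ∈ a ∷ as × proj₂ x ∈ bs (proj₁ x) → x ∈ map (a ,_) (bs a) ++ l
  complete (here refl , b∈) = ∈-++⁺ˡ (∈-map⁺ (a ,_) b∈)
  complete (there a∈ , b∈) = ∈-++⁺ʳ (map (a ,_) (bs a)) (c (a∈ , b∈))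

<⇒∃+ : ∀ {m n} → m < n → ∃[ d ] 0 < d × m + d ≡ n
<⇒∃+ {m} {n} m<n = n ∸ m , m<n⇒0<n∸m m<n , m+[n∸m]≡n (<⇒≤ m<n)

m≤m*n′ : ∀ m {n} → 0 < n → m ≤ m * n
m≤m*n′ m {n} 0<n = m≤m*n m n {{>-nonZero 0<n}}

m≤m*m : ∀ m → m ≤ m * m
m≤m*m zero      = z≤n
m≤m*m m@(suc _) = m≤m*n m m

0<m*n : ∀ {m n} → 0 < m → 0 < n → 0 < m * n
0<m*n = *-mono-<

∈-positivesUpTo⁺ : ∀ {m n} → 0 < m → m ≤ n → m ∈ positivesUpTo n
∈-positivesUpTo⁺ {suc m} _ m<n = ∈-map⁺ suc (∈-upTo⁺ m<n)

∈-positivesUpTo⁻ : ∀ {m n} → m ∈ positivesUpTo n → 0 < m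
∈-positivesUpTo⁻ m∈ with ∈-map⁻ suc m∈
... | _ , _ , refl = z<s

positivesUpTo-unique : ∀ n → Unique (positivesUpTo n)
positivesUpTo-unique n = Unique.map⁺ suc-injective (Unique.upTo⁺ n)

-- Residues

module _ (m : ℕ) .{{_ : NonZero m}} where

  %-reduce : ∀ k y z → (k * k + y * z) % m ≡ ((k % m) * (k % m) + (y % m) * (z % m)) % m
  %-reduce k y z = trans (%-distribˡ-+ (k * k) (y * z) m)
    (trans (cong₂ (λ a b → (a + b) % m) (%-distribˡ-* k k m) (%-distribˡ-* y z m))
      (sym (%-distribˡ-+ ((k % m) * (k % m)) ((y % m) * (z % m)) m)))

  -- The bounded quantifiers have the shape that `allUpTo?` decides, so each modulus is settled by a
  -- finite search.
  NonSum₂Residue : ℕ → Set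
  NonSum₂Residue r = ∀ {i} → i < m → ∀ {j} → j < m → (i * i + j * j) % m ≢ r

  nonSum₂Residue? : Decidable NonSum₂Residue
  nonSum₂Residue? r = allUpTo? (λ i → allUpTo? (λ j → ¬? ((i * i + j * j) % m ≟ r)) m) m

  nonSum₂ : ∀ {r N} → NonSum₂Residue r → N % m ≡ r → ∀ i j → i * i + j * j ≢ N
  nonSum₂ res N%m i j refl =
    res (m%n<n i m) (m%n<n j m) (trans (sym (%-reduce i j j)) N%m)

[mk*n+b]%m : ∀ m k n b .{{_ : NonZero m}} → (m * k * n + b) % m ≡ b % m
[mk*n+b]%m m k n b = trans (cong (_% m) (rearrange m k n b)) ([m+kn]%n≡m%n b (k * n) m)
  where
  rearrange : ∀ m k n b → m * k * n + b ≡ b + k * n * m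
  rearrange = solve-∀

%2-from-%4 : ∀ m → m % 2 ≡ m % 4 % 2
%2-from-%4 m = sym (m∣n⇒o%n%m≡o%m 2 4 m (divides 2 refl))

%4≡⇒%2≡ : ∀ {m n} → m % 4 ≡ n % 4 → m % 2 ≡ n % 2
%4≡⇒%2≡ {m} {n} eq = trans (%2-from-%4 m) (trans (cong (_% 2) eq) (sym (%2-from-%4 n)))

module _ (k y z : ℕ) (eq : (k * k + y * z) % 4 ≡ 2) where

  private
    -- If y ≡ 0, then k² ≡ 2, which is impossible. If k is even, then yz ≡ 2, so exactly one of y
    -- and z is even. If k is odd, then yz ≡ 1, so y ≡ z; the last clause is the contrapositive. All
    -- 64 residue triples are checked.
    Residues : ℕ → ℕ → ℕ → Set
    Residues k y z = (k * k + y * z) % 4 ≡ 2 →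
      y ≢ 0 × (k % 2 ≡ 0 → y % 2 ≢ z % 2) × (y ≢ z → k % 2 ≡ 0)

    residues? : Dec (∀ {k} → k < 4 → ∀ {y} → y < 4 → ∀ {z} → z < 4 → Residues k y z)
    residues? = allUpTo? (λ k → allUpTo? (λ y → allUpTo? (λ z →
      ((k * k + y * z) % 4 ≟ 2) →-dec
      (¬? (y ≟ 0) ×-dec ((k % 2 ≟ 0) →-dec ¬? (y % 2 ≟ z % 2)) ×-dec (¬? (y ≟ z) →-dec (k % 2 ≟ 0))))
      4) 4) 4

    residues : Residues (k % 4) (y % 4) (z % 4)
    residues = from-yes residues? (m%n<n k 4) (m%n<n y 4) (m%n<n z 4)

    reduced : ((k % 4) * (k % 4) + (y % 4) * (z % 4)) % 4 ≡ 2
    reduced = trans (sym (%-reduce 4 k y z)) eq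

  y%4≢0 : y % 4 ≢ 0
  y%4≢0 = proj₁ (residues reduced)

  even-k⇒y≢z[2] : k % 2 ≡ 0 → y % 2 ≢ z % 2
  even-k⇒y≢z[2] k-even y≡z = proj₁ (proj₂ (residues reduced))
    (trans (sym (%2-from-%4 k)) k-even)
    (trans (sym (%2-from-%4 y)) (trans y≡z (%2-from-%4 z)))

  y≢z[4]⇒even-k : y % 4 ≢ z % 4 → k % 2 ≡ 0
  y≢z[4]⇒even-k y≢z = trans (%2-from-%4 k) (proj₂ (proj₂ (residues reduced)) y≢z)

even⇒*2 : ∀ {m} → m % 2 ≡ 0 → ∃[ h ] m ≡ h * 2
even⇒*2 {m} e with m%n≡0⇒n∣m m 2 e
... | divides h eq = h , eq

-- With equal remainders the inequality must come from the quotients, and w is their difference.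
≡[4]∧<⇒∃ : ∀ {y z} → y % 4 ≡ z % 4 → y < z → ∃[ w ] 0 < w × y + 4 * w ≡ z
≡[4]∧<⇒∃ {y} {z} y≡z y<z with <⇒∃+ (≰⇒> z/4≰y/4)
  where
  z/4≰y/4 : ¬ (z / 4 ≤ y / 4)
  z/4≰y/4 le = <⇒≱ y<z (subst₂ _≤_ (sym (m≡m%n+[m/n]*n z 4)) (sym (m≡m%n+[m/n]*n y 4))
    (+-mono-≤ (≤-reflexive (sym y≡z)) (*-monoˡ-≤ 4 le)))
... | w , 0<w , eq = w , 0<w , (begin
  y + 4 * w                        ≡⟨ cong (_+ 4 * w) (m≡m%n+[m/n]*n y 4) ⟩
  y % 4 + y / 4 * 4 + 4 * w        ≡⟨ rearrange (y % 4) (y / 4) w ⟩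
  y % 4 + (y / 4 + w) * 4          ≡⟨ cong₂ (λ r q → r + q * 4) y≡z eq ⟩
  z % 4 + z / 4 * 4                ≡⟨ m≡m%n+[m/n]*n z 4 ⟨
  z                                ∎)
  where
  open ≡-Reasoning
  rearrange : ∀ r q w → r + q * 4 + 4 * w ≡ r + (q + w) * 4
  rearrange = solve-∀

-- Coordinates on the classes and regions of solutions

oddMap : ℕ × ℕ × ℕ → ℕ × ℕ × ℕ
oddMap (k , x , w) = k , x , x + 4 * w

oddMap-injective : ∀ {a a′} → oddMap a ≡ oddMap a′ → a ≡ a′
oddMap-injective {k , x , w} {k′ , x′ , w′} eq with cong proj₁ eq | cong (proj₁ ∘ proj₂) eq
... | refl | refl = cong (λ w → k , x , w)
  (*-cancelˡ-≡ w w′ 4 (+-cancelˡ-≡ x (4 * w) (4 * w′) (cong (proj₂ ∘ proj₂) eq)))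

evenMap : ℕ × ℕ × ℕ → ℕ × ℕ × ℕ
evenMap (j , u , z) = j * 2 , u * 2 , z

evenMap-injective : ∀ {a a′} → evenMap a ≡ evenMap a′ → a ≡ a′
evenMap-injective {j , u , z} {j′ , u′ , z′} eq =
  cong₂ _,_ (*-cancelʳ-≡ j j′ 2 (cong proj₁ eq))
    (cong₂ _,_ (*-cancelʳ-≡ u u′ 2 (cong (proj₁ ∘ proj₂) eq)) (cong (proj₂ ∘ proj₂) eq))

-- For y > x + z Zagier's involution sends (x, y, z) to (x + 2z, z, y - x - z). The coordinates (s,
-- y, t) stand for (x, z, y - x - z): `farMap` gives the point and `farMap′` its image, both without
-- subtraction.
farMap : ℕ × ℕ × ℕ × ℕ → ℕ × ℕ × ℕ × ℕ
farMap (k , s , y , t) = k , s , s + y + t , y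

farMap-injective : ∀ {a a′} → farMap a ≡ farMap a′ → a ≡ a′
farMap-injective {k , s , y , t} {k′ , s′ , y′ , t′} eq
  with cong proj₁ eq | cong (proj₁ ∘ proj₂) eq | cong (proj₂ ∘ proj₂ ∘ proj₂) eq
... | refl | refl | refl = cong (λ t → k , s , y , t)
  (+-cancelˡ-≡ (s + y) t t′ (cong (proj₁ ∘ proj₂ ∘ proj₂) eq))

farMap′ : ℕ × ℕ × ℕ × ℕ → ℕ × ℕ × ℕ × ℕ
farMap′ (k , s , y , t) = k , 2 * y + s , y , t

farMap′-injective : ∀ {a a′} → farMap′ a ≡ farMap′ a′ → a ≡ a′
farMap′-injective {k , s , y , t} {k′ , s′ , y′ , t′} eq
  with cong proj₁ eq | cong (proj₁ ∘ proj₂ ∘ proj₂) eq | cong (proj₂ ∘ proj₂ ∘ proj₂) eq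
... | refl | refl | refl = cong (λ s → k , s , y , t)
  (+-cancelˡ-≡ (2 * y) s s′ (cong (proj₁ ∘ proj₂) eq))

-- The middle branch of Zagier's involution is (x, y, z) ↦ (2y - x, y, x - y + z). With w = x, d = y
-- - x and e = x + z - y, `nearMap` gives a point with x < y and `nearMap′` its image.
nearMap : ℕ × ℕ × ℕ × ℕ → ℕ × ℕ × ℕ × ℕ
nearMap (k , w , d , e) = k , w , w + d , d + e

nearMap-injective : ∀ {a a′} → nearMap a ≡ nearMap a′ → a ≡ a′
nearMap-injective {k , w , d , e} {k′ , w′ , d′ , e′} eq with cong proj₁ eq | cong (proj₁ ∘ proj₂) eq
... | refl | refl with +-cancelˡ-≡ w d d′ (cong (proj₁ ∘ proj₂ ∘ proj₂) eq)
...   | refl = cong (λ e → k , w , d , e) (+-cancelˡ-≡ d e e′ (cong (proj₂ ∘ proj₂ ∘ proj₂) eq))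

nearMap′ : ℕ × ℕ × ℕ × ℕ → ℕ × ℕ × ℕ × ℕ
nearMap′ (k , w , d , e) = k , w + d + d , w + d , e

nearMap′-injective : ∀ {a a′} → nearMap′ a ≡ nearMap′ a′ → a ≡ a′
nearMap′-injective {k , w , d , e} {k′ , w′ , d′ , e′} eq
  with cong proj₁ eq | cong (proj₂ ∘ proj₂ ∘ proj₂) eq
     -- The third components turn the equation of the second ones into `w + d + d ≡ w + d + d′`.
     | +-cancelˡ-≡ (w + d) d d′ (trans (cong (proj₁ ∘ proj₂) eq)
         (cong (_+ d′) (sym (cong (proj₁ ∘ proj₂ ∘ proj₂) eq))))
... | refl | refl | refl =
  cong (λ w → k , w , d , e) (+-cancelʳ-≡ d w w′ (cong (proj₁ ∘ proj₂ ∘ proj₂) eq))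

-- Solution sets and their finiteness

module _ (N : ℕ) where

  Pairs : ℕ × ℕ → Set
  Pairs (j , u) = 0 < j × 0 < u × (j * 2) * (j * 2) + (u * 2) * u ≡ N

  Triples : ℕ × ℕ × ℕ → Set
  Triples (k , y , z) = 0 < k × 0 < y × 0 < z × k * k + y * z ≡ N

  -- The equation is literally that of `Triples` at the image under `evenMap`, so its proof
  -- transfers unchanged. When N ≡ 2 (mod 4) it forces z to be odd.
  EvenTriples : ℕ × ℕ × ℕ → Set
  EvenTriples (j , u , z) = 0 < j × 0 < u × 0 < z × (j * 2) * (j * 2) + (u * 2) * z ≡ N

  OddTriples : ℕ × ℕ × ℕ → Set
  OddTriples (k , x , w) = 0 < k × 0 < x × 0 < w × k * k + x * (x + 4 * w) ≡ N

  ThreeSquares : ℕ × ℕ × ℕ → Set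
  ThreeSquares (k , x , y) = 0 < k × 0 < x × 0 < y × k * k + (x * x + 4 * (y * y)) ≡ N

  Quadruples : ℕ × ℕ × ℕ × ℕ → Set
  Quadruples (k , x , y , z) =
    0 < k × 0 < x × 0 < y × 0 < z × k * k + (x * x + 4 * (y * z)) ≡ N

  -- The outer Zagier regions y > x + z and x > 2y, in the coordinates of
  -- ZagierFar, and the inner ones x < y and y < x, in those of ZagierNear.
  ZagierFar : ℕ × ℕ × ℕ × ℕ → Set
  ZagierFar (k , s , y , t) =
    0 < k × 0 < s × 0 < y × 0 < t × k * k + (s * s + 4 * (y * (s + y + t))) ≡ N

  ZagierNear : ℕ × ℕ × ℕ × ℕ → Set
  ZagierNear (k , w , d , e) =
    0 < k × 0 < w × 0 < d × 0 < e × k * k + (w * w + 4 * ((w + d) * (d + e))) ≡ N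

  -- The coordinate z is the divisor of N - k² complementary to y, so a triple is determined by the
  -- pair (k, y) that the sum counts.
  card-Triples : Card Triples (divisorSumOverSquares N)
  card-Triples = card-pullback (λ (k , y , z) → k , y) to inj surj
    (card-Σ {as = roots} divisors
      (Unique.filter⁺ (λ k → k * k <? N) (positivesUpTo-unique N))
      (λ k → Unique.filter⁺ (_∣? (N ∸ k * k)) (positivesUpTo-unique (N ∸ k * k))))
    where
    roots : List ℕ
    roots = filter (λ k → k * k <? N) (positivesUpTo N)
    divisors : ℕ → List ℕ
    divisors k = filter (_∣? (N ∸ k * k)) (positivesUpTo (N ∸ k * k))
    to : ∀ {a} → Triples a → proj₁ a ∈ roots × proj₁ (proj₂ a) ∈ divisors (proj₁ a)
    to {k , y , z} (0<k , 0<y , 0<z , refl) =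
      ∈-filter⁺ (λ k → k * k <? N) (∈-positivesUpTo⁺ 0<k (≤-trans (m≤m*m k) (m≤m+n (k * k) (y * z))))
        (m<m+n (k * k) (0<m*n 0<y 0<z)) ,
      ∈-filter⁺ (_∣? (N ∸ k * k))
        (∈-positivesUpTo⁺ 0<y (subst (y ≤_) (sym (m+n∸m≡n (k * k) (y * z))) (m≤m*n′ y 0<z)))
        (subst (y ∣_) (sym (m+n∸m≡n (k * k) (y * z))) (m∣m*n z))
    inj : ∀ {a a′} → Triples a → Triples a′ →
      (proj₁ a , proj₁ (proj₂ a)) ≡ (proj₁ a′ , proj₁ (proj₂ a′)) → a ≡ a′
    inj {k , y , z} {_ , _ , z′} (_ , 0<y , _ , eq) (_ , _ , _ , eq′) refl =
      cong (λ z → k , y , z) (*-cancelˡ-≡ z z′ y {{>-nonZero 0<y}}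
        (+-cancelˡ-≡ (k * k) (y * z) (y * z′) (trans eq (sym eq′))))
    surj : ∀ {b} → proj₁ b ∈ roots × proj₂ b ∈ divisors (proj₁ b) →
      ∃[ a ] Triples a × (proj₁ a , proj₁ (proj₂ a)) ≡ b
    surj {k , y} (k∈ , y∈)
      with ∈-filter⁻ (λ k → k * k <? N) {xs = positivesUpTo N} k∈
         | ∈-filter⁻ (_∣? (N ∸ k * k)) {xs = positivesUpTo (N ∸ k * k)} y∈
    ... | k∈′ , k²<N | y∈′ , divides z eq =
      (k , y , z) , (∈-positivesUpTo⁻ k∈′ , ∈-positivesUpTo⁻ y∈′ , 0<z ,
        trans (cong (k * k +_) (trans (*-comm y z) (sym eq))) (m+[n∸m]≡n (<⇒≤ k²<N))) , refl
      where
      0<z : 0 < z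
      0<z = n≢0⇒n>0 λ z≡0 →
        <-irrefl (sym (trans eq (cong (_* y) z≡0))) (m<n⇒0<n∸m k²<N)

  -- The number itself is immaterial: it will be evaluated modulo 2 in two ways. Positivity bounds
  -- every coordinate by N, so the solutions can be filtered from a box.
  finite-Quadruples : ∃ (Card Quadruples)
  finite-Quadruples with card-filter Quadruples? boxed
    where
    side = upTo (suc N)
    box = cartesianProduct side (cartesianProduct side (cartesianProduct side side))
    u = Unique.upTo⁺ (suc N)
    boxed : Card (_∈ box) (length box)
    boxed = card box
      (Unique.cartesianProduct⁺ u (Unique.cartesianProduct⁺ u (Unique.cartesianProduct⁺ u u)))
      (λ a∈ → a∈) (λ a∈ → a∈) refl
    Quadruples? : Decidable Quadruples
    Quadruples? (k , x , y , z) = 0 <? k ×-dec 0 <? x ×-dec 0 <? y ×-dec 0 <? z ×-dec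
      (k * k + (x * x + 4 * (y * z)) ≟ N)
  ... | m , M = m , card-cong proj₂ (λ {a} q → bounded a q , q) M
    where
    bounded : ∀ a → Quadruples a → _
    bounded (k , x , y , z) (_ , _ , 0<y , 0<z , refl) =
      ∈-cartesianProduct⁺ (∈-upTo⁺ (s≤s k≤N)) (∈-cartesianProduct⁺ (∈-upTo⁺ (s≤s x≤N))
        (∈-cartesianProduct⁺ (∈-upTo⁺ (s≤s y≤N)) (∈-upTo⁺ (s≤s z≤N))))
      where
      yz≤N : y * z ≤ N
      yz≤N = ≤-trans (m≤n*m (y * z) 4) (≤-trans (m≤n+m (4 * (y * z)) (x * x)) (m≤n+m _ (k * k)))
      k≤N : k ≤ N
      k≤N = ≤-trans (m≤m*m k) (m≤m+n (k * k) _)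
      x≤N : x ≤ N
      x≤N = ≤-trans (m≤m*m x) (≤-trans (m≤m+n (x * x) _) (m≤n+m _ (k * k)))
      y≤N : y ≤ N
      y≤N = ≤-trans (m≤m*n′ y 0<z) yz≤N
      z≤N : z ≤ N
      z≤N = ≤-trans (m≤m*n′ z 0<y) (≤-trans (≤-reflexive (*-comm z y)) yz≤N)

  -- Involutions that exchange two coordinates

  evenTriples-parity : ∀ {n} → Card EvenTriples n → ∃₂ λ m d → Card Pairs d × n ≡ m + m + d
  evenTriples-parity #E
    with card-swap (λ (j , u , z) → u) (λ (j , u , z) → z)
           (λ (j , u , z) → j , z , u) (λ _ → refl) (λ _ → refl)
           (λ {(j , u , z)} (0<j , 0<u , 0<z , eq) →
             0<j , 0<z , 0<u , trans (symmetric j z u) eq) #E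
    where
    symmetric : ∀ j u z → (j * 2) * (j * 2) + (u * 2) * z ≡ (j * 2) * (j * 2) + (z * 2) * u
    symmetric = solve-∀
  ... | m , d , _ , #≡ , refl = m , d ,
    card-pullback (λ (j , u) → j , u , u)
      (λ (0<j , 0<u , eq) → (0<j , 0<u , 0<u , eq) , refl)
      (λ { _ _ refl → refl })
      (λ { {j , u , _} ((0<j , 0<u , _ , eq) , refl) → (j , u) , (0<j , 0<u , eq) , refl }) #≡
    , refl

  threeSquares-parity : ∀ {n} → Card ThreeSquares n → ∃₂ λ m d → Card Pairs d × n ≡ m + m + d
  threeSquares-parity #F
    with card-swap (λ (k , x , y) → k) (λ (k , x , y) → x)
           (λ (k , x , y) → x , k , y) (λ _ → refl) (λ _ → refl)
           (λ {(k , x , y)} (0<k , 0<x , 0<y , eq) →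
             0<x , 0<k , 0<y , trans (symmetric x k y) eq) #F
    where
    symmetric : ∀ k x y → k * k + (x * x + 4 * (y * y)) ≡ x * x + (k * k + 4 * (y * y))
    symmetric = solve-∀
  ... | m , d , _ , #≡ , refl = m , d ,
    -- The repeated coordinate k = x becomes u and the old y becomes j: u² + u² + 4j² = (2j)² + 2u².
    card-pullback (λ (j , u) → u , u , j)
      (λ {(j , u)} (0<j , 0<u , eq) → (0<u , 0<u , 0<j , trans (sym (diagonal j u)) eq) , refl)
      (λ { _ _ refl → refl })
      (λ { {u , _ , j} ((0<u , _ , 0<j , eq) , refl) →
        (j , u) , (0<j , 0<u , trans (diagonal j u) eq) , refl }) #≡
    , refl
    where
    diagonal : ∀ j u → (j * 2) * (j * 2) + (u * 2) * u ≡ u * u + (u * u + 4 * (j * j))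
    diagonal = solve-∀

  quadruples-swap : ∀ {n} → Card Quadruples n → ∃₂ λ m f → Card ThreeSquares f × n ≡ m + m + f
  quadruples-swap #Z
    with card-swap (λ (k , x , y , z) → y) (λ (k , x , y , z) → z)
           (λ (k , x , y , z) → k , x , z , y) (λ _ → refl) (λ _ → refl)
           (λ {(k , x , y , z)} (0<k , 0<x , 0<y , 0<z , eq) →
             0<k , 0<x , 0<z , 0<y , trans (symmetric k x z y) eq) #Z
    where
    symmetric : ∀ k x y z → k * k + (x * x + 4 * (y * z)) ≡ k * k + (x * x + 4 * (z * y))
    symmetric = solve-∀
  ... | m , f , _ , #≡ , refl = m , f ,
    card-pullback (λ (k , x , y) → k , x , y , y)
      (λ (0<k , 0<x , 0<y , eq) → (0<k , 0<x , 0<y , 0<y , eq) , refl)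
      (λ { _ _ refl → refl })
      (λ { {k , x , y , _} ((0<k , 0<x , 0<y , _ , eq) , refl) →
        (k , x , y) , (0<k , 0<x , 0<y , eq) , refl }) #≡
    , refl

  -- Residue classes of triples and Zagier's involution

  module _ (N≡2 : N % 4 ≡ 2) (N≢□+□ : ∀ i j → i * i + j * j ≢ N) where

    triples-by-parity : ∀ {n} → Card Triples n →
      ∃₂ λ o e → Card OddTriples o × Card EvenTriples e × n ≡ 2 * (o + e)
    triples-by-parity #T
      with card-split #T {Q = λ (k , y , z) → y % 4 ≡ z % 4} (λ (k , y , z) → y % 4 ≟ z % 4)
    ... | _ , _ , T≡ , T≢ , refl
      with card-swap (λ (k , y , z) → y) (λ (k , y , z) → z)
             (λ (k , y , z) → k , z , y) (λ _ → refl) (λ _ → refl)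
             (λ {(k , y , z)} ((0<k , 0<y , 0<z , eq) , y≡z) →
               (0<k , 0<z , 0<y , trans (cong (k * k +_) (*-comm z y)) eq) , sym y≡z) T≡
         -- Comparing parities instead of sizes selects from each swapped pair the member with y
         -- even and z odd.
         | card-swap (λ (k , y , z) → y % 2) (λ (k , y , z) → z % 2)
             (λ (k , y , z) → k , z , y) (λ _ → refl) (λ _ → refl)
             (λ {(k , y , z)} ((0<k , 0<y , 0<z , eq) , y≢z) →
               (0<k , 0<z , 0<y , trans (cong (k * k +_) (*-comm z y)) eq) , y≢z ∘ sym) T≢
    ... | o , _ , #< , #≡ , refl | e , _ , #<₂ , #≡₂ , refl
      -- Both diagonals are empty: y = z would make N = k² + y², and y ≢ z (mod 4) makes k even,
      -- hence y and z of different parity.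
      rewrite card-empty #≡ (λ (k , y , z) (((_ , _ , _ , eq) , _) , y≡z) →
                N≢□+□ k y (trans (cong (λ z → k * k + y * z) y≡z) eq))
            | card-empty #≡₂ (λ (k , y , z) (((_ , _ , _ , eq) , y≢z) , y≡z) →
                let eq4 = trans (cong (_% 4) eq) N≡2 in
                even-k⇒y≢z[2] k y z eq4 (y≢z[4]⇒even-k k y z eq4 y≢z) y≡z)
      = o , e , odd , even , rearrange o e
      where
      rearrange : ∀ o e → o + o + 0 + (e + e + 0) ≡ 2 * (o + e)
      rearrange = solve-∀
      odd : Card OddTriples o
      odd = card-pullback oddMap
        (λ {(k , x , w)} (0<k , 0<x , 0<w , eq) →
          ((0<k , 0<x , ≤-trans 0<x (m≤m+n x (4 * w)) , eq) ,
           sym (trans (cong (λ v → (x + v) % 4) (*-comm 4 w)) ([m+kn]%n≡m%n x w 4))) ,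
          m<m+n x (0<m*n (z<s {3}) 0<w))
        (λ _ _ → oddMap-injective)
        (λ { {k , y , z} (((0<k , 0<y , _ , eq) , y≡z) , y<z) → surj 0<k 0<y eq (≡[4]∧<⇒∃ y≡z y<z) })
        #<
        where
        surj : ∀ {k y z} → 0 < k → 0 < y → k * k + y * z ≡ N → ∃[ w ] 0 < w × y + 4 * w ≡ z →
          ∃[ a ] OddTriples a × oddMap a ≡ (k , y , z)
        surj {k} {y} 0<k 0<y eq (w , 0<w , refl) = (k , y , w) , (0<k , 0<y , 0<w , eq) , refl
      even : Card EvenTriples e
      even = card-pullback evenMap
        (λ {(j , u , z)} (0<j , 0<u , 0<z , eq) →
          ((0<m*n 0<j (z<s {1}) , 0<m*n 0<u (z<s {1}) , 0<z , eq) ,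
           y≢z[2] j u z eq ∘ %4≡⇒%2≡ {u * 2} {z}) ,
          subst (_< z % 2) (sym (m*n%n≡0 u 2))
            (n≢0⇒n>0 (λ z≡0 → y≢z[2] j u z eq (trans (m*n%n≡0 u 2) (sym z≡0)))))
        (λ _ _ → evenMap-injective)
        (λ { {k , y , z} (((0<k , 0<y , 0<z , eq) , y≢z) , y<z) →
          surj 0<k 0<y 0<z eq
            (even⇒*2 (y≢z[4]⇒even-k k y z (trans (cong (_% 4) eq) N≡2) y≢z))
            -- Here `y<z` compares the residues: y % 2 < z % 2 ≤ 1.
            (even⇒*2 {y} (n<1⇒n≡0 (≤-trans y<z (≤-pred (m%n<n z 2))))) })
        #<₂
        where
        y≢z[2] : ∀ j u z → (j * 2) * (j * 2) + (u * 2) * z ≡ N → (u * 2) % 2 ≢ z % 2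
        y≢z[2] j u z eq =
          even-k⇒y≢z[2] (j * 2) (u * 2) z (trans (cong (_% 4) eq) N≡2) (m*n%n≡0 j 2)
        surj : ∀ {k y z} → 0 < k → 0 < y → 0 < z → k * k + y * z ≡ N →
          ∃[ j ] k ≡ j * 2 → ∃[ u ] y ≡ u * 2 → ∃[ a ] EvenTriples a × evenMap a ≡ (k , y , z)
        surj {z = z} 0<k 0<y 0<z eq (j , refl) (u , refl) =
          (j , u , z) , (*-cancelʳ-< _ 0 j 0<k , *-cancelʳ-< _ 0 u 0<y , 0<z , eq) , refl

    -- The planes y = x + z, x = 2y and x = y cut the solutions into four open regions. The
    -- involution matches the two outer and the two inner regions, which appears here as a common
    -- parametrization of each couple. The first two planes contain no solution, and on x = y the
    -- form is k² + x(x + 4z).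
    quadruples-zagier : ∀ {n} → Card Quadruples n → ∃₂ λ m o → Card OddTriples o × n ≡ m + m + o
    quadruples-zagier #Z
      with card-trichotomy (λ (k , x , y , z) → y) (λ (k , x , y , z) → x + z) #Z
    ... | _ , _ , far , #y<x+z , #y≡x+z , #x+z<y , refl
      with card-trichotomy (λ (k , x , y , z) → x) (λ (k , x , y , z) → 2 * y) #y<x+z
    ... | _ , _ , far′ , #x<2y , #x≡2y , #2y<x , refl
      with card-trichotomy (λ (k , x , y , z) → x) (λ (k , x , y , z) → y) #x<2y
    ... | near , o , near′ , #x<y , #x≡y , #y<x , refl
      = near + far , o , #O , assemble
          -- On y = x + z the form is k² + (x + 2z)², a sum of two squares.
          (card-empty #y≡x+z λ { (k , x , _ , z) ((_ , _ , _ , _ , eq) , refl) →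
            N≢□+□ k (x + 2 * z) (trans (square k x z) eq) })
          -- On x = 2y the form is k² + 4(y² + yz); `y%4≢0` is applied with the factor 4 in the
          -- place of y.
          (card-empty #x≡2y λ { (k , _ , y , z) (((_ , _ , _ , _ , eq) , _) , refl) →
            y%4≢0 k 4 (y * y + y * z)
              (trans (cong (_% 4) (trans (multiple k y z) eq)) N≡2) refl })
          (card-unique #far′ #far)
          (card-unique #near′ #near)
      where
      square : ∀ k x z → k * k + (x + 2 * z) * (x + 2 * z) ≡ k * k + (x * x + 4 * ((x + z) * z))
      square = solve-∀
      multiple : ∀ k y z → k * k + 4 * (y * y + y * z) ≡ k * k + ((2 * y) * (2 * y) + 4 * (y * z))
      multiple = solve-∀
      assemble : ∀ {near near′ far far′ e e′ o} → e ≡ 0 → e′ ≡ 0 → far′ ≡ far → near′ ≡ near →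
        near + (o + near′) + (e′ + far′) + (e + far) ≡ near + far + (near + far) + o
      assemble {near} {_} {far} {o = o} refl refl refl refl = rearrange near far o
        where
        rearrange : ∀ near far o →
          near + (o + near) + (0 + far) + (0 + far) ≡ near + far + (near + far) + o
        rearrange = solve-∀

      #O : Card OddTriples o
      #O = card-pullback (λ (k , x , w) → k , x , x , w)
        (λ {(k , x , w)} (0<k , 0<x , 0<w , eq) →
          (((0<k , 0<x , 0<x , 0<w , trans (distrib k x w) eq) , m<m+n x 0<w) ,
            m<m+n x (≤-trans 0<x (≤-reflexive (sym (+-identityʳ x))))) , refl)
        (λ { _ _ refl → refl })
        (λ { {k , x , _ , w} ((((0<k , 0<x , _ , 0<w , eq) , _) , _) , refl) →
          (k , x , w) , (0<k , 0<x , 0<w , trans (sym (distrib k x w)) eq) , refl })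
        #x≡y
        where
        distrib : ∀ k x w → k * k + (x * x + 4 * (x * w)) ≡ k * k + x * (x + 4 * w)
        distrib = solve-∀

      #far : Card ZagierFar far
      #far = card-pullback farMap
        (λ {(k , s , y , t)} (0<k , 0<s , 0<y , 0<t , eq) →
          (0<k , 0<s , ≤-trans 0<t (m≤n+m t (s + y)) , 0<y , trans (commute k s y t) eq) ,
          m<m+n (s + y) 0<t)
        (λ _ _ → farMap-injective)
        (λ { {k , s , _ , y} ((0<k , 0<s , _ , 0<y , eq) , s+y<) → surj 0<k 0<s 0<y eq (<⇒∃+ s+y<) })
        #x+z<y
        where
        commute : ∀ k s y t →
          k * k + (s * s + 4 * ((s + y + t) * y)) ≡ k * k + (s * s + 4 * (y * (s + y + t)))
        commute = solve-∀
        surj : ∀ {k s y v} → 0 < k → 0 < s → 0 < y → k * k + (s * s + 4 * (v * y)) ≡ N →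
          ∃[ t ] 0 < t × s + y + t ≡ v → ∃[ a ] ZagierFar a × farMap a ≡ (k , s , v , y)
        surj {k} {s} {y} 0<k 0<s 0<y eq (t , 0<t , refl) =
          (k , s , y , t) , (0<k , 0<s , 0<y , 0<t , trans (sym (commute k s y t)) eq) , refl

      #far′ : Card ZagierFar far′
      #far′ = card-pullback farMap′
        (λ {(k , s , y , t)} (0<k , 0<s , 0<y , 0<t , eq) →
          ((0<k , ≤-trans 0<s (m≤n+m s (2 * y)) , 0<y , 0<t , trans (expand k s y t) eq) ,
            ≤-<-trans (≤-trans (m≤n*m y 2) (m≤m+n (2 * y) s)) (m<m+n (2 * y + s) 0<t)) ,
          m<m+n (2 * y) 0<s)
        (λ _ _ → farMap′-injective)
        (λ { {k , _ , y , t} (((0<k , _ , 0<y , 0<t , eq) , _) , 2y<) → surj 0<k 0<y 0<t eq (<⇒∃+ 2y<) })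
        #2y<x
        where
        expand : ∀ k s y t →
          k * k + ((2 * y + s) * (2 * y + s) + 4 * (y * t)) ≡ k * k + (s * s + 4 * (y * (s + y + t)))
        expand = solve-∀
        surj : ∀ {k x y t} → 0 < k → 0 < y → 0 < t → k * k + (x * x + 4 * (y * t)) ≡ N →
          ∃[ s ] 0 < s × 2 * y + s ≡ x → ∃[ a ] ZagierFar a × farMap′ a ≡ (k , x , y , t)
        surj {k} {_} {y} {t} 0<k 0<y 0<t eq (s , 0<s , refl) =
          (k , s , y , t) , (0<k , 0<s , 0<y , 0<t , trans (sym (expand k s y t)) eq) , refl

      #near : Card ZagierNear near
      #near = card-pullback nearMap
        (λ {(k , w , d , e)} (0<k , 0<w , 0<d , 0<e , eq) →
          (((0<k , 0<w , ≤-trans 0<w (m≤m+n w d) , ≤-trans 0<d (m≤m+n d e) , eq) ,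
            +-monoʳ-< w (m<m+n d 0<e)) ,
            <-≤-trans (m<m+n w 0<d) (m≤n*m (w + d) 2)) ,
          m<m+n w 0<d)
        (λ _ _ → nearMap-injective)
        (λ { {k , w , y , z} ((((0<k , 0<w , _ , 0<z , eq) , y<w+z) , _) , w<y) →
          surj 0<k 0<w eq y<w+z (<⇒∃+ w<y) })
        #x<y
        where
        surj : ∀ {k w y z} → 0 < k → 0 < w → k * k + (w * w + 4 * (y * z)) ≡ N → y < w + z →
          ∃[ d ] 0 < d × w + d ≡ y → ∃[ a ] ZagierNear a × nearMap a ≡ (k , w , y , z)
        surj {k} {w} {_} {z} 0<k 0<w eq y<w+z (d , 0<d , refl) with <⇒∃+ (+-cancelˡ-< w d z y<w+z)
        ... | e , 0<e , refl = (k , w , d , e) , (0<k , 0<w , 0<d , 0<e , eq) , refl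

      #near′ : Card ZagierNear near′
      #near′ = card-pullback nearMap′
        (λ {(k , w , d , e)} (0<k , 0<w , 0<d , 0<e , eq) →
          (((0<k , ≤-trans 0<d (m≤n+m d (w + d)) , ≤-trans 0<w (m≤m+n w d) , 0<e ,
             trans (expand k w d e) eq) ,
            ≤-<-trans (m≤m+n (w + d) d) (m<m+n (w + d + d) 0<e)) ,
            +-monoʳ-< (w + d) (<-≤-trans (m<n+m d 0<w) (≤-reflexive (sym (+-identityʳ (w + d)))))) ,
          m<m+n (w + d) 0<d)
        (λ _ _ → nearMap′-injective)
        (λ { {k , x , y , e} ((((0<k , _ , _ , 0<e , eq) , _) , x<2y) , y<x) →
          surj 0<k 0<e eq x<2y (<⇒∃+ y<x) })
        #y<x
        where
        expand : ∀ k w d e →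
          k * k + ((w + d + d) * (w + d + d) + 4 * ((w + d) * e)) ≡
          k * k + (w * w + 4 * ((w + d) * (d + e)))
        expand = solve-∀
        surj : ∀ {k x y e} → 0 < k → 0 < e → k * k + (x * x + 4 * (y * e)) ≡ N → x < 2 * y →
          ∃[ d ] 0 < d × y + d ≡ x → ∃[ a ] ZagierNear a × nearMap′ a ≡ (k , x , y , e)
        surj {k} {_} {y} {e} 0<k 0<e eq x<2y (d , 0<d , refl)
          -- Since `2 * y` unfolds to `y + (y + 0)`, cancelling y from x = y + d < 2y leaves d < y,
          -- and w is y - d. This produces y as `d + w`, while `nearMap′` expects `w + d`.
          with <⇒∃+ (<-≤-trans (+-cancelˡ-< y d (y + 0) x<2y) (≤-reflexive (+-identityʳ y)))
        ... | w , 0<w , refl with +-comm d w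
        ...   | d+w≡w+d rewrite d+w≡w+d =
          (k , w , d , e) , (0<k , 0<w , 0<d , 0<e , trans (sym (expand k w d e)) eq) , refl

    -- Divisibility by 4 and the five progressions

    4∣divisorSum : divisorSumOverSquares N % 4 ≡ 0
    4∣divisorSum with triples-by-parity card-Triples | finite-Quadruples
    ... | o , e , #O , #E , S≡ | z , #Z
      with evenTriples-parity #E | quadruples-swap #Z | quadruples-zagier #Z
    ... | m₁ , d , #D , e≡ | m₂ , f , #F , z≡ | m₃ , o′ , #O′ , z≡′
      with threeSquares-parity #F
    ... | m₄ , d′ , #D′ , f≡
      -- The odd triples met in the divisor sum are those fixed by Zagier's involution, and both
      -- remaining diagonals are `Pairs`.
      rewrite card-unique #O′ #O | card-unique #D′ #D
      = n∣m⇒m%n≡0 (divisorSumOverSquares N) 4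
          (subst (4 ∣_) (sym S≡) (*-monoʳ-∣ 2 (∣m+n∣m⇒∣n (divides (m₂ + m₄ + d + m₁) total) (divides m₃ refl))))
      where
      -- Both sides equal z + e. The left side uses z = 2m₃ + o; on the right z = 2m₂ + f, and f and
      -- e each contribute one d. Adding 2m₃ avoids subtraction.
      total : m₃ * 2 + (o + e) ≡ (m₂ + m₄ + d + m₁) * 2
      total = begin
        m₃ * 2 + (o + e)                          ≡⟨ cong (λ e → m₃ * 2 + (o + e)) e≡ ⟩
        m₃ * 2 + (o + (m₁ + m₁ + d))              ≡⟨ regroup m₃ o m₁ d ⟩
        m₃ + m₃ + o + (m₁ + m₁ + d)               ≡⟨ cong (_+ (m₁ + m₁ + d)) (trans (sym z≡′) z≡) ⟩
        m₂ + m₂ + f + (m₁ + m₁ + d)               ≡⟨ cong (λ f → m₂ + m₂ + f + (m₁ + m₁ + d)) f≡ ⟩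
        m₂ + m₂ + (m₄ + m₄ + d) + (m₁ + m₁ + d)   ≡⟨ double m₁ m₂ m₄ d ⟩
        (m₂ + m₄ + d + m₁) * 2                    ∎
        where
        open ≡-Reasoning
        regroup : ∀ m₃ o m₁ d → m₃ * 2 + (o + (m₁ + m₁ + d)) ≡ m₃ + m₃ + o + (m₁ + m₁ + d)
        regroup = solve-∀
        double : ∀ m₁ m₂ m₄ d →
          m₂ + m₂ + (m₄ + m₄ + d) + (m₁ + m₁ + d) ≡ (m₂ + m₄ + d + m₁) * 2
        double = solve-∀

-- The common difference is a multiple of 4 and of the obstructing modulus m, so both residues of N
-- are those of b.
4∣divisorSum-progression : ∀ k b n m l .{{_ : NonZero m}} → 4 * k ≡ m * l → b % 4 ≡ 2 →
  NonSum₂Residue m (b % m) → divisorSumOverSquares (4 * k * n + b) % 4 ≡ 0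
4∣divisorSum-progression k b n m l 4k≡ml b≡2 residue = 4∣divisorSum (4 * k * n + b)
  (trans ([mk*n+b]%m 4 k n b) b≡2)
  (nonSum₂ m residue (trans (cong (λ a → (a * n + b) % m) 4k≡ml) ([mk*n+b]%m m l n b)))

theorem1p1 : (A B n : ℕ) → AdmissiblePair A B →
    divisorSumOverSquares (A * n + B) % 4 ≡ 0
-- The obstruction is 2-adic: N / 2 ≡ 7 (mod 8).
theorem1p1 _ _ n p16-14 =
  4∣divisorSum-progression 4 14 n 16 1 refl refl (from-yes (nonSum₂Residue? 16 14))
-- The residues 3 and 6 modulo 9 say that the prime 3 divides N exactly once.
theorem1p1 _ _ n p36-30 =
  4∣divisorSum-progression 9 30 n 9 4 refl refl (from-yes (nonSum₂Residue? 9 3))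
theorem1p1 _ _ n p72-42 =
  4∣divisorSum-progression 18 42 n 9 8 refl refl (from-yes (nonSum₂Residue? 9 6))
-- Here 70 ≡ 21 (mod 49), so the prime 7 divides N exactly once.
theorem1p1 _ _ n p196-70 =
  4∣divisorSum-progression 49 70 n 49 4 refl refl (from-yes (nonSum₂Residue? 49 21))
theorem1p1 _ _ n p252-114 =
  4∣divisorSum-progression 63 114 n 9 28 refl refl (from-yes (nonSum₂Residue? 9 6))
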